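{- Let $(\mathsf P,\mathcal O)$ be a semitopology. Then the map $\mathrm{nbhd}:\mathsf P\to\mathrm{Points}(\mathcal O,\subseteq,\between)$, $p\mapsto\{O\in\mathcal O\mid p\in O\}$, is a continuous map from $(\mathsf P,\mathcal O)$ to $\mathrm{St}(\mathcal O,\subseteq,\between)$; the semitopology $\mathrm{St}(\mathcal O,\subseteq,\between)$ is sober; and $\mathrm{nbhd}^{ -1}$ maps each open set $\mathrm{Op}(O)$ of $\mathrm{St}(\mathcal O,\subseteq,\between)$ to $O$, giving a bijection between the open sets of $\mathrm{St}(\mathcal O,\subseteq,\between)$ and $\mathcal O$ which preserves and reflects both subset inclusion and nonempty intersection (an isomorphism of semiframes).
   Context: A semitopology is a set $\mathsf P$ with $\mathcal O\subseteq\mathcal P(\mathsf P)$ containing $\varnothing,\mathsf P$ and closed under arbitrary unions; a map between semitopologies is continuous when preimages of open sets are open. $(\mathcal O,\subseteq,\between)$, with $O\between O'$ iff $O\cap O'\neq\varnothing$, is a semiframe. In a semiframe (complete join-semilattice $(X,\le)$ with commutative $\ast$, $x\ast x$ for $x\neq\bot$, and $x\ast\bigvee Y$ iff $\exists y\in Y.\,x\ast y$), an abstract point is a nonempty, up-closed, pairwise $\ast$-compatible, completely prime subset ($\bigvee Y\in F\Rightarrow\exists y\in Y.\,y\in F$, for all $Y$ including $\varnothing$); $\mathrm{Points}(X,\le,\ast)$ is the set of abstract points; $\mathrm{Op}(x)$ is the set of abstract points containing $x$; $\mathrm{St}(X,\le,\ast)$ is the semitopology with points $\mathrm{Points}(X,\le,\ast)$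 and opens $\{\mathrm{Op}(x)\mid x\in X\}$. A semitopology is sober when $\mathrm{nbhd}$ is a bijection from its points onto the abstract points of its semiframe of open sets. -}

module Defs where

open import Axiom.ExcludedMiddle using (ExcludedMiddle)
open import Data.Empty.Polymorphic using (⊥)
open import Data.Product.Base using (Σ; ∃; _,_; proj₁; proj₂)
open import Data.Unit.Polymorphic using (tt)
open import Function.Base using (_∘_)
open import Function.Bundles using (Func; _⇔_; mk⇔)
open import Function.Definitions using (Bijective)
open import Level using (Level; _⊔_; suc)
open import Relation.Binary.Bundles using (Setoid; Poset)
open import Relation.Binary.Core using (Rel)
open import Relation.Binary.Definitions
  using (Maximum; Symmetric; _Respects_; _Respects₂_)
import Relation.Binary.Construct.On as On
open import Relation.Nullary.Decidable.Core using (yes; no)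
open import Relation.Nullary.Negation.Core using (¬_; contradiction)
open import Relation.Unary
  using (Pred; _∈_; _⊆_; _≐_; _≬_; _⊢_; ⋃; Satisfiable)
open import Relation.Unary.Polymorphic using (∅; U)
open import Relation.Unary.Properties using (≐-refl)
open import Relation.Unary.Relation.Binary.Equality using (≐-setoid)
open import Relation.Unary.Relation.Binary.Subset using (⊆-poset)

private
  variable
    p e ℓ o c ℓ₁ ℓ₂ r p′ e′ o′ c′ ℓ₁′ ℓ₂′ r′ : Level

-- Subsets of the point set are predicates valued in Set ℓ, taken up to
-- _≐_; points form a setoid so that abstract points, which are themselves
-- subsets, can serve as points.  A set of open sets is given as a family
-- indexed by a type in Set ℓ, as only such unions stay in Pred _ ℓ.  When
-- the points live in Set ℓ this is, under excluded middle, no restriction: the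
-- union of any collection Y of subsets is the union of a subfamily of Y
-- indexed by the points x of that union, with x assigned a member of Y
-- containing it.

record Semitopology (p e ℓ o : Level) : Set (suc (p ⊔ e ⊔ ℓ ⊔ o)) where
  field
    points : Setoid p e

  open Setoid points public using () renaming (Carrier to Point; _≈_ to _≈ₚ_)

  field
    IsOpen      : Pred (Pred Point ℓ) o
    open-resp-≈ : ∀ {V} → IsOpen V → V Respects _≈ₚ_
    open-resp-≐ : IsOpen Respects _≐_
    ∅-open      : IsOpen ∅
    U-open      : IsOpen U
    ⋃-open      : {I : Set ℓ} (V : I → Pred Point ℓ) →
                  (∀ i → IsOpen (V i)) → IsOpen (⋃ I V)

  Open : Set (p ⊔ suc ℓ ⊔ o)
  Open = Σ (Pred Point ℓ) IsOpen

module _ (S : Semitopology p e ℓ o) (T : Semitopology p′ e′ ℓ o′) where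
  private
    module S = Semitopology S
    module T = Semitopology T

  Continuous : Func S.points T.points → Set _
  Continuous f = ∀ V → T.IsOpen V → S.IsOpen (Func.to f ⊢ V)

  preimage : (f : Func S.points T.points) → Continuous f → T.Open → S.Open
  preimage f cont (V , V-open) = Func.to f ⊢ V , cont V V-open

-- The data (X, ≤, ∗) of a semiframe, with joins of families indexed by Set ℓ.
-- The greatest element is the join of all of X; it is listed separately
-- because X itself need not live in Set ℓ.

record PreSemiframe (c ℓ₁ ℓ₂ r ℓ : Level) : Set (suc (c ⊔ ℓ₁ ⊔ ℓ₂ ⊔ r ⊔ ℓ)) where
  field
    poset : Poset c ℓ₁ ℓ₂

  open Poset poset public

  field
    ⋁       : {I : Set ℓ} → (I → Carrier) → Carrier
    ⋁-upper : {I : Set ℓ} (y : I → Carrier) → ∀ i → y i ≤ ⋁ y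
    ⋁-least : {I : Set ℓ} (y : I → Carrier) →
              ∀ z → (∀ i → y i ≤ z) → ⋁ y ≤ z
    ⊤       : Carrier
    ⊤-max   : Maximum _≤_ ⊤
    _∗_     : Rel Carrier r
    ∗-resp-≈ : _∗_ Respects₂ _≈_

  ⊥ₓ : Carrier
  ⊥ₓ = ⋁ {⊥} λ ()

record IsSemiframe (X : PreSemiframe c ℓ₁ ℓ₂ r ℓ)
       : Set (c ⊔ ℓ₁ ⊔ r ⊔ suc ℓ) where
  open PreSemiframe X
  field
    ∗-comm    : Symmetric _∗_
    ∗-proper  : ∀ x → ¬ (x ≈ ⊥ₓ) → x ∗ x
    ∗-distrib : {I : Set ℓ} (x : Carrier) (y : I → Carrier) →
                (x ∗ ⋁ y) ⇔ (∃ λ i → x ∗ y i)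

module _ (X : PreSemiframe c ℓ₁ ℓ₂ r ℓ) (Y : PreSemiframe c′ ℓ₁′ ℓ₂′ r′ ℓ) where
  private
    module X = PreSemiframe X
    module Y = PreSemiframe Y

  record IsSemiframeIsomorphism (f : X.Carrier → Y.Carrier)
         : Set (c ⊔ ℓ₁ ⊔ ℓ₂ ⊔ r ⊔ c′ ⊔ ℓ₁′ ⊔ ℓ₂′ ⊔ r′) where
    field
      bijective : Bijective X._≈_ Y._≈_ f
      cong      : ∀ {x y} → x X.≈ y → f x Y.≈ f y
      ≤-iff     : ∀ x y → (x X.≤ y) ⇔ (f x Y.≤ f y)
      ∗-iff     : ∀ x y → (x X.∗ y) ⇔ (f x Y.∗ f y)

module _ (X : PreSemiframe c ℓ₁ ℓ₂ r ℓ) where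
  open PreSemiframe X

  record IsAbstractPoint (F : Pred Carrier ℓ)
         : Set (c ⊔ ℓ₂ ⊔ r ⊔ suc ℓ) where
    field
      nonempty         : Satisfiable F
      up-closed        : ∀ {x y} → x ≤ y → x ∈ F → y ∈ F
      compatible       : ∀ {x y} → x ∈ F → y ∈ F → x ∗ y
      completely-prime : {I : Set ℓ} (y : I → Carrier) →
                         ⋁ y ∈ F → ∃ λ i → y i ∈ F

  Points : Setoid (c ⊔ ℓ₂ ⊔ r ⊔ suc ℓ) (c ⊔ ℓ)
  Points = On.setoid (≐-setoid Carrier ℓ) (proj₁ {B = IsAbstractPoint})

  Op : Carrier → Pred (Setoid.Carrier Points) ℓ
  Op x (F , _) = x ∈ F

  St : Semitopology (c ⊔ ℓ₂ ⊔ r ⊔ suc ℓ) (c ⊔ ℓ) ℓ (c ⊔ ℓ₂ ⊔ r ⊔ suc ℓ)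
  St = record
    { points      = Points
    ; IsOpen      = λ V → ∃ λ x → V ≐ Op x
    ; open-resp-≈ = λ (x , V⊆ , V⊇) F≐G F∈V → V⊇ (proj₁ F≐G (V⊆ F∈V))
    ; open-resp-≐ = λ (V⊆W , W⊆V) (x , V⊆ , V⊇) →
                      x , (λ w → V⊆ (W⊆V w)) , (λ m → V⊆W (V⊇ m))
    ; ∅-open      = ⊥ₓ , (λ ()) , λ {F} m →
                      proj₁ (completely-prime (proj₂ F) (λ ()) m)
    ; U-open      = ⊤ , (λ {F} _ → let x , x∈F = nonempty (proj₂ F) in
                      up-closed (proj₂ F) (⊤-max x) x∈F) , λ _ → tt
    ; ⋃-open      = λ V opn → let x = proj₁ ∘ opn in
        ⋁ x
      , (λ {F} (i , F∈Vi) →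
           up-closed (proj₂ F) (⋁-upper x i) (proj₁ (proj₂ (opn i)) F∈Vi))
      , (λ {F} m → let i , xi∈F = completely-prime (proj₂ F) x m in
           i , proj₂ (proj₂ (opn i)) xi∈F)
    }
    where open IsAbstractPoint

  OpOpen : Carrier → Semitopology.Open St
  OpOpen x = Op x , x , ≐-refl

module _ (S : Semitopology p e ℓ o) where
  open Semitopology S

  opens : PreSemiframe (p ⊔ suc ℓ ⊔ o) (p ⊔ ℓ) (p ⊔ ℓ) (p ⊔ ℓ) ℓ
  opens = record
    { poset    = On.poset (⊆-poset Point ℓ) (proj₁ {B = IsOpen})
    ; ⋁        = λ {I} V → ⋃ I (proj₁ ∘ V) , ⋃-open (proj₁ ∘ V) (proj₂ ∘ V)
    ; ⋁-upper  = λ V i x∈Vi → i , x∈Vi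
    ; ⋁-least  = λ V W V⊆W (i , x∈Vi) → V⊆W i x∈Vi
    ; ⊤        = U , U-open
    ; ⊤-max    = λ _ _ → tt
    ; _∗_      = λ (V , _) (W , _) → V ≬ W
    ; ∗-resp-≈ = (λ W≐W′ (x , v , w) → x , v , proj₁ W≐W′ w)
               , (λ V≐V′ (x , v , w) → x , proj₁ V≐V′ v , w)
    }

  -- Excluded middle is needed only for "V ≠ ∅ implies V ≬ V".
  opens-isSemiframe : ExcludedMiddle (p ⊔ ℓ) → IsSemiframe opens
  opens-isSemiframe em = record
    { ∗-comm    = λ (x , v , w) → x , w , v
    ; ∗-proper  = proper
    ; ∗-distrib = λ V W → mk⇔ (λ (x , v , i , w) → i , x , v , w)
                              (λ (i , x , v , w) → x , v , i , w)
    }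
    where
    open PreSemiframe opens using (_≈_; ⊥ₓ; _∗_)

    proper : ∀ V → ¬ (V ≈ ⊥ₓ) → V ∗ V
    proper V V≉⊥ with em {proj₁ V ≬ proj₁ V}
    ... | yes V≬V = V≬V
    ... | no ¬V≬V = contradiction
          ((λ {x} v → contradiction (x , v , v) ¬V≬V) , λ ()) V≉⊥

  nbhd : Func points (Points opens)
  nbhd = record
    { to   = λ x → (λ V → x ∈ proj₁ V) , record
        { nonempty         = (U , U-open) , tt
        ; up-closed        = λ V⊆W → V⊆W
        ; compatible       = λ v w → x , v , w
        ; completely-prime = λ V m → m
        }
    ; cong = λ x≈y → (λ {V} → open-resp-≈ (proj₂ V) x≈y)
                   , (λ {V} → open-resp-≈ (proj₂ V) (Setoid.sym points x≈y))
    }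

  Sober : Set _
  Sober = Bijective _≈ₚ_ (Setoid._≈_ (Points opens)) (Func.to nbhd)

{-# OPTIONS --safe #-}

-- An open set of St X is Op x for some x, and Op x determines x through any
-- abstract point containing it.  Hence an abstract point 𝓕 of the opens of St X
-- is nbhd F for F = { x | Op x ∈ 𝓕 }.  For X = opens S, the preimage of Op O
-- under nbhd is O itself, so Op inverts nbhd⁻¹; it preserves inclusion because
-- abstract points are up-closed, and nbhd⁻¹ preserves intersection because
-- abstract points are pairwise compatible.

module Submission where

open import Defs
open import Data.Product using (Σ-syntax; _×_; _,_; proj₁; proj₂)
open import Function.Bundles using (Func; mk⇔)
open import Level using (Level)
open import Relation.Binary.Bundles using (Setoid)
open import Relation.Unary using (_∈_)
open import Relation.Unary.Properties using (≐-refl)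

private
  variable
    p e c ℓ o ℓ₁ ℓ₂ r : Level

module _ (X : PreSemiframe c ℓ₁ ℓ₂ r ℓ) where
  open PreSemiframe X
  open IsAbstractPoint
  private
    module Pt = Setoid (Points X)
    module Pt² = Setoid (Points (opens (St X)))

  Op⁻¹ : Pt².Carrier → Pt.Carrier
  Op⁻¹ (𝓕 , 𝓕-point) = (λ x → OpOpen X x ∈ 𝓕) , record
    { nonempty         = let (V , x , V⊆ , _) , V∈𝓕 = nonempty 𝓕-point in
                         x , up-closed 𝓕-point V⊆ V∈𝓕
    ; up-closed        = λ x≤y →
        up-closed 𝓕-point λ {F} → up-closed (proj₂ F) x≤y
    ; compatible       = λ x y →
        -- The witness of `Op x ≬ Op y` is an abstract point `G` containing both `x` and `y`.
        let (G , G-point) , x∈G , y∈G = compatible 𝓕-point x y in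
        compatible G-point x∈G y∈G
    ; completely-prime = λ y ⋁y →
        completely-prime 𝓕-point (λ i → OpOpen X (y i))
          -- Complete primeness of each `F` says that `Op (⋁ y)` lies in the union of the
          -- `Op (y i)`.
          (up-closed 𝓕-point (λ {F} → completely-prime (proj₂ F) y) ⋁y)
    }

  -- An open `V` is only `≐` to some `Op x`; up-closure of `𝓕` carries membership across in both
  -- directions.
  nbhd-Op⁻¹ : ∀ 𝓕 → Func.to (nbhd (St X)) (Op⁻¹ 𝓕) Pt².≈ 𝓕
  nbhd-Op⁻¹ (𝓕 , 𝓕-point) =
      (λ {(V , x , V⊆ , V⊇)} F∈V → up-closed 𝓕-point V⊇ (V⊆ F∈V))
    , (λ {(V , x , V⊆ , V⊇)} V∈𝓕 → V⊇ (up-closed 𝓕-point V⊆ V∈𝓕))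

  St-sober : Sober (St X)
  St-sober =
      -- Tested on the open set `Op x`, `nF≐nG` compares `x ∈ F` with `x ∈ G`.
      (λ {F} {G} nF≐nG → (λ {x} → proj₁ nF≐nG {OpOpen X x})
                       , (λ {x} → proj₂ nF≐nG {OpOpen X x}))
    , λ 𝓕 → Op⁻¹ 𝓕 , λ {F} F≈ →
        Pt².trans {Func.to (nbhd (St X)) F} {Func.to (nbhd (St X)) (Op⁻¹ 𝓕)} {𝓕}
          (Func.cong (nbhd (St X)) {F} {Op⁻¹ 𝓕} F≈) (nbhd-Op⁻¹ 𝓕)

module _ (S : Semitopology p e ℓ o) where
  open Semitopology S
  open IsAbstractPoint

  -- The preimage of `Op O` unfolds to `O`, so that of `V ≐ Op O` is `≐` to `O`.
  nbhd-continuous : Continuous S (St (opens S)) (nbhd S)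
  nbhd-continuous V (O , V⊆ , V⊇) = open-resp-≐ (V⊇ , V⊆) (proj₂ O)

  private
    T = St (opens S)
    module O = PreSemiframe (opens S)
    module OT = PreSemiframe (opens T)

    nbhd⁻¹ : OT.Carrier → O.Carrier
    nbhd⁻¹ = preimage S T (nbhd S) nbhd-continuous

  nbhd⁻¹-reflects-⊆ : ∀ V W → nbhd⁻¹ V O.≤ nbhd⁻¹ W → V OT.≤ W
  nbhd⁻¹-reflects-⊆ (V , O , V⊆ , V⊇) (W , Q , W⊆ , W⊇) le {F} F∈V =
    -- Reading `s∈O` as `nbhd s ∈ Op O` turns `le` into `O ⊆ Q`, along which `F` is up-closed.
    W⊇ (up-closed (proj₂ F) {O} {Q} (λ s∈O → W⊆ (le (V⊇ s∈O))) (V⊆ F∈V))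

  nbhd⁻¹-preserves-≬ : ∀ V W → V OT.∗ W → nbhd⁻¹ V O.∗ nbhd⁻¹ W
  nbhd⁻¹-preserves-≬ (V , O , V⊆ , V⊇) (W , Q , W⊆ , W⊇) (F , F∈V , F∈W) =
    let s , s∈O , s∈Q = compatible (proj₂ F) {O} {Q} (V⊆ F∈V) (W⊆ F∈W) in
    s , V⊇ s∈O , W⊇ s∈Q

  nbhd⁻¹-isSemiframeIsomorphism : IsSemiframeIsomorphism (opens T) (opens S) nbhd⁻¹
  nbhd⁻¹-isSemiframeIsomorphism = record
    { bijective =
          (λ {V} {W} V≈W → (λ {F} → nbhd⁻¹-reflects-⊆ V W (proj₁ V≈W) {F})
                         , (λ {F} → nbhd⁻¹-reflects-⊆ W V (proj₂ V≈W) {F}))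
        , λ O → OpOpen (opens S) O , λ V≈ → (λ s → proj₁ V≈ s) , (λ s → proj₂ V≈ s)
    ; cong  = λ V≈W → (λ s → proj₁ V≈W s) , (λ s → proj₂ V≈W s)
    ; ≤-iff = λ V W →
        mk⇔ {A = V OT.≤ W} {B = nbhd⁻¹ V O.≤ nbhd⁻¹ W}
          (λ V⊆W s → V⊆W s)
          (λ le {F} → nbhd⁻¹-reflects-⊆ V W le {F})
    ; ∗-iff = λ V W → mk⇔ (nbhd⁻¹-preserves-≬ V W)
                          -- A common point `s` of the preimages gives the common abstract point
                          -- `nbhd s`.
                          (λ (s , v , w) → Func.to (nbhd S) s , v , w)
    }

theorem8p5 : ∀ {p e ℓ o : Level} (S : Semitopology p e ℓ o) →
    let open PreSemiframe (opens S) using (_≈_)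
        nbhd⁻¹ = preimage S (St (opens S)) (nbhd S)
    in
    Σ[ cont ∈ Continuous S (St (opens S)) (nbhd S) ]
      Sober (St (opens S))
      × (∀ O → nbhd⁻¹ cont (OpOpen (opens S) O) ≈ O)
      × IsSemiframeIsomorphism (opens (St (opens S))) (opens S) (nbhd⁻¹ cont)
theorem8p5 S =
    nbhd-continuous S
  , St-sober (opens S)
  , (λ O → ≐-refl)
  , nbhd⁻¹-isSemiframeIsomorphism S
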